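{- Let $\lambda$ and $\mu$ be partitions. The toggle map $\nu\mapsto(T(\nu),n)$ relative to $\lambda$ and $\mu$ is a bijection from the set of partitions $\nu$ with $\mu\prec\nu\succ\lambda$ to the set of pairs $(\nu',n)$ consisting of a partition $\nu'$ with $\mu\succ\nu'\prec\lambda$ and an integer $n\ge0$. Moreover, it preserves weight in the following manner: for every such $\nu$, with $n$ the entry popped off in the toggle, $$|\nu|-|\lambda| = |\mu|-|T(\nu)|+n \quad\text{and}\quad |\nu|-|\mu| = |\lambda|-|T(\nu)|+n.$$
   Context: A partition is a weakly decreasing sequence $\lambda=(\lambda_1,\lambda_2,\dots)$ of nonnegative integers with finitely many nonzero terms; $|\lambda|=\sum_i\lambda_i$. We write $\lambda\succ\mu$ (equivalently $\mu\prec\lambda$) if $\lambda_1\ge\mu_1\ge\lambda_2\ge\mu_2\ge\cdots$. Toggle: for partitions with $\lambda\prec\nu\succ\mu$, the toggle of $\nu$ relative to $\lambda$ and $\mu$ is the pair $(T(\nu),n)$, where $$T(\nu)_i=\min\{\lambda_i,\mu_i\}+\max\{\lambda_{i+1},\mu_{i+1}\}-\nu_{i+1}\qquad(i\ge1),$$ and $n=\nu_1-\max\{\lambda_1,\mu_1\}$ is the value popped off. -}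

module Defs where

open import Level using (0ℓ)
open import Data.Nat.Base using (ℕ; suc; _≤_; _⊓_; _⊔_)
open import Data.Integer.Base using (ℤ; +_; _+_; _-_)
open import Data.List.Base using (applyUpTo)
open import Data.Nat.ListAction using (sum)
open import Data.Product.Base using (Σ; _×_; proj₁)
open import Data.Product.Relation.Binary.Pointwise.NonDependent using (_×ₛ_)
open import Relation.Binary.Bundles using (Setoid)
open import Relation.Binary.PropositionalEquality using (_≡_; _→-setoid_; setoid)
import Relation.Binary.Construct.On as On

infix 4 _≻_ _≺_

-- Indices start at 0, so `part i` is the (i+1)-st entry of the sequence.
-- `bound` is only a witness of finiteness, not part of the partition's
-- identity: it may be any number from which on all parts vanish.
record Partition : Set where
  field
    part       : ℕ → ℕ
    decreasing : ∀ i → part (suc i) ≤ part i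
    bound      : ℕ
    vanishing  : ∀ i → bound ≤ i → part i ≡ 0

open Partition public

partitionSetoid : Setoid 0ℓ 0ℓ
partitionSetoid = On.setoid (ℕ →-setoid ℕ) part

-- The omitted parts are all 0, so this does not depend on the choice of `bound`.
weight : Partition → ℕ
weight ƛ = sum (applyUpTo (part ƛ) (bound ƛ))

_≻_ : Partition → Partition → Set
ƛ ≻ μ = ∀ i → part μ i ≤ part ƛ i × part ƛ (suc i) ≤ part μ i

_≺_ : Partition → Partition → Set
μ ≺ ƛ = ƛ ≻ μ

-- Two elements are equal when their partitions have the same parts; the
-- interlacing proofs are ignored.
Above : Partition → Partition → Setoid 0ℓ 0ℓ
Above ƛ μ = On.setoid {B = Σ Partition (λ ν → μ ≺ ν × ν ≻ ƛ)} partitionSetoid proj₁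

Below : Partition → Partition → Setoid 0ℓ 0ℓ
Below ƛ μ = On.setoid {B = Σ Partition (λ ν′ → μ ≻ ν′ × ν′ ≺ ƛ)} partitionSetoid proj₁

BelowWithPopped : Partition → Partition → Setoid 0ℓ 0ℓ
BelowWithPopped ƛ μ = Below ƛ μ ×ₛ setoid ℕ

-- The entries of the toggle and the popped value are computed in ℤ, so that
-- subtraction is not truncated; that they are nonnegative is not presupposed.
toggledPart : (ƛ μ ν : Partition) → ℕ → ℤ
toggledPart ƛ μ ν i =
  + (part ƛ i ⊓ part μ i) + + (part ƛ (suc i) ⊔ part μ (suc i)) - + part ν (suc i)

popped : (ƛ μ ν : Partition) → ℤ
popped ƛ μ ν = + part ν 0 - + (part ƛ 0 ⊔ part μ 0)

-- `(ν′ , n)` is the toggle of ν relative to ƛ and μ.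
IsToggle : (ƛ μ ν ν′ : Partition) → ℕ → Set
IsToggle ƛ μ ν ν′ n =
  (∀ i → + part ν′ i ≡ toggledPart ƛ μ ν i) × + n ≡ popped ƛ μ ν

{-# OPTIONS --safe #-}
-- Put a = λ ∧ μ and b = λ ∨ μ (entrywise min and max).  Then ν lies above λ and μ
-- iff b₁ ≤ ν₁ and bᵢ₊₁ ≤ νᵢ₊₁ ≤ aᵢ for all i, and ν′ lies below them iff
-- bᵢ₊₁ ≤ ν′ᵢ ≤ aᵢ for all i.  The toggle reflects νᵢ₊₁ in the interval [bᵢ₊₁ , aᵢ]
-- and records ν₁ - b₁, so it is inverted by the same reflections.  Summing
-- T(ν)ᵢ + νᵢ₊₁ = aᵢ + bᵢ₊₁ and using aᵢ + bᵢ = λᵢ + μᵢ gives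
-- |ν| + |T(ν)| = |λ| + |μ| + n.
module Submission where

open import Defs
open import Data.Integer.Base using (+_; _+_; _-_)
open import Data.Product.Base using (Σ; Σ-syntax; _×_; _,_; proj₁; proj₂)
open import Function.Bundles using (Bijection)
open import Relation.Binary.PropositionalEquality using (_≡_)

open import Data.Nat.Base as ℕ using (ℕ; zero; suc; _≤_; z≤n; s≤s; _⊓_; _⊔_; _∸_)
import Data.Nat.Properties as ℕ
open import Data.Nat.ListAction using (sum)
import Data.Nat.Tactic.RingSolver as ℕ-Solver
open import Data.Integer.Base using (ℤ)
import Data.Integer.Tactic.RingSolver as ℤ-Solver
open import Data.List.Base using (applyUpTo)
open import Data.Sum.Base using (inj₁; inj₂)
open import Function.Base using (_∘_)
open import Function.Bundles using (Inverse)
open import Function.Properties.Inverse using (Inverse⇒Bijection)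
open import Relation.Binary.PropositionalEquality using (refl; sym; trans; cong; cong₂; subst; module ≡-Reasoning)

-- Arithmetic of min, max and integer differences

m⊓n+m⊔n≡m+n : ∀ m n → (m ⊓ n) ℕ.+ (m ⊔ n) ≡ m ℕ.+ n
m⊓n+m⊔n≡m+n m n with ℕ.≤-total m n
... | inj₁ m≤n = cong₂ ℕ._+_ (ℕ.m≤n⇒m⊓n≡m m≤n) (ℕ.m≤n⇒m⊔n≡n m≤n)
... | inj₂ n≤m = trans (cong₂ ℕ._+_ (ℕ.m≥n⇒m⊓n≡n n≤m) (ℕ.m≥n⇒m⊔n≡m n≤m)) (ℕ.+-comm n m)

-- Passage from ℕ to ℤ: identities are proved additively in ℕ and turned into integer differences
-- only at the end.
m+n≡o⇒+m≡+o-+n : ∀ {m n o} → m ℕ.+ n ≡ o → + m ≡ + o - + n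
m+n≡o⇒+m≡+o-+n {m} {n} refl = cancel (+ m) (+ n)
  where
  cancel : ∀ (i j : ℤ) → i ≡ i + j - j
  cancel = ℤ-Solver.solve-∀

-- Reflection in an interval

infix 4 _∈[_,_]

_∈[_,_] : ℕ → ℕ → ℕ → Set
x ∈[ l , u ] = l ≤ x × x ≤ u

-- The truncated subtraction is exact on the interval, where `x ≤ u ≤ u + l`.
reflect : (l u x : ℕ) → ℕ
reflect l u x = u ℕ.+ l ∸ x

module _ {l u x : ℕ} (x∈ : x ∈[ l , u ]) where

  private
    l≤x = proj₁ x∈
    x≤u = proj₂ x∈

  x≤u+l : x ≤ u ℕ.+ l
  x≤u+l = ℕ.m≤n⇒m≤n+o l x≤u

  reflect-∈ : reflect l u x ∈[ l , u ]
  reflect-∈ =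
    ℕ.m+n≤o⇒m≤o∸n l (subst (l ℕ.+ x ≤_) (ℕ.+-comm l u) (ℕ.+-monoʳ-≤ l x≤u)) ,
    ℕ.m≤n+o⇒m∸n≤o (u ℕ.+ l) x
      (subst (_≤ x ℕ.+ u) (ℕ.+-comm l u) (ℕ.+-monoˡ-≤ u l≤x))

  reflect-involutive : reflect l u (reflect l u x) ≡ x
  reflect-involutive = ℕ.m∸[m∸n]≡n x≤u+l

  reflect+id : reflect l u x ℕ.+ x ≡ u ℕ.+ l
  reflect+id = ℕ.m∸n+n≡m x≤u+l

-- Weights as finite sums

sum-vanishing : ∀ (f : ℕ → ℕ) {m n} → m ≤ n → (∀ i → m ≤ i → f i ≡ 0) →
                sum (applyUpTo f n) ≡ sum (applyUpTo f m)
sum-vanishing f {n = zero}  z≤n       f≡0 = refl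
sum-vanishing f {n = suc n} z≤n       f≡0 =
  cong₂ ℕ._+_ (f≡0 0 z≤n) (sum-vanishing (f ∘ suc) {n = n} z≤n λ i _ → f≡0 (suc i) z≤n)
sum-vanishing f             (s≤s m≤n) f≡0 =
  cong (f 0 ℕ.+_) (sum-vanishing (f ∘ suc) m≤n λ i m≤i → f≡0 (suc i) (s≤s m≤i))

sum-+-cong : ∀ {f g h k : ℕ → ℕ} → (∀ i → f i ℕ.+ g i ≡ h i ℕ.+ k i) → ∀ n →
             sum (applyUpTo f n) ℕ.+ sum (applyUpTo g n) ≡
             sum (applyUpTo h n) ℕ.+ sum (applyUpTo k n)
sum-+-cong                 eq zero    = refl
sum-+-cong {f} {g} {h} {k} eq (suc n) = begin
  (f 0 ℕ.+ F) ℕ.+ (g 0 ℕ.+ G)  ≡⟨ interchange (f 0) F (g 0) G ⟩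
  (f 0 ℕ.+ g 0) ℕ.+ (F ℕ.+ G)  ≡⟨ cong₂ ℕ._+_ (eq 0) (sum-+-cong (eq ∘ suc) n) ⟩
  (h 0 ℕ.+ k 0) ℕ.+ (H ℕ.+ K)  ≡⟨ interchange (h 0) (k 0) H K ⟩
  (h 0 ℕ.+ H) ℕ.+ (k 0 ℕ.+ K)  ∎
  where
  open ≡-Reasoning
  open import Algebra.Properties.CommutativeSemigroup ℕ.+-commutativeSemigroup using (interchange)
  F = sum (applyUpTo (f ∘ suc) n)
  G = sum (applyUpTo (g ∘ suc) n)
  H = sum (applyUpTo (h ∘ suc) n)
  K = sum (applyUpTo (k ∘ suc) n)

weight-upTo : ∀ p {n} → bound p ≤ n → sum (applyUpTo (part p) n) ≡ weight p
weight-upTo p b≤n = sum-vanishing (part p) b≤n (vanishing p)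

-- The four weights are cut off at different bounds. Extending every sum to the largest bound adds
-- only zeros, after which the sums compare termwise.
weight-+-cong : ∀ p q r s → (∀ i → part p i ℕ.+ part q i ≡ part r i ℕ.+ part s i) →
                weight p ℕ.+ weight q ≡ weight r ℕ.+ weight s
weight-+-cong p q r s eq = begin
  weight p ℕ.+ weight q      ≡⟨ cong₂ ℕ._+_ (weight-upTo p p≤n) (weight-upTo q q≤n) ⟨
  upTo p n ℕ.+ upTo q n      ≡⟨ sum-+-cong eq n ⟩
  upTo r n ℕ.+ upTo s n      ≡⟨ cong₂ ℕ._+_ (weight-upTo r r≤n) (weight-upTo s s≤n) ⟩
  weight r ℕ.+ weight s      ∎
  where
  open ≡-Reasoning
  upTo : Partition → ℕ → ℕ
  upTo t m = sum (applyUpTo (part t) m)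
  n = (bound p ⊔ bound q) ⊔ (bound r ⊔ bound s)
  p≤n : bound p ≤ n
  p≤n = ℕ.m≤n⇒m≤n⊔o (bound r ⊔ bound s) (ℕ.m≤m⊔n (bound p) (bound q))
  q≤n : bound q ≤ n
  q≤n = ℕ.m≤n⇒m≤n⊔o (bound r ⊔ bound s) (ℕ.m≤n⊔m (bound p) (bound q))
  r≤n : bound r ≤ n
  r≤n = ℕ.m≤n⇒m≤o⊔n (bound p ⊔ bound q) (ℕ.m≤m⊔n (bound r) (bound s))
  s≤n : bound s ≤ n
  s≤n = ℕ.m≤n⇒m≤o⊔n (bound p ⊔ bound q) (ℕ.m≤n⊔m (bound r) (bound s))

tail : Partition → Partition
tail p = record
  { part       = part p ∘ suc
  ; decreasing = decreasing p ∘ suc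
  -- Keeping the bound of `p` makes `part p 0 + weight (tail p)` definitionally the sum of `p` up to
  -- `suc (bound p)`, as `weight-head-tail` uses.
  ; bound      = bound p
  ; vanishing  = λ i b≤i → vanishing p (suc i) (ℕ.m≤n⇒m≤1+n b≤i)
  }

weight-head-tail : ∀ p → weight p ≡ part p 0 ℕ.+ weight (tail p)
weight-head-tail p = sym (weight-upTo p (ℕ.n≤1+n _))

_∧_ _∨_ : Partition → Partition → Partition
p ∧ q = record
  { part       = λ i → part p i ⊓ part q i
  ; decreasing = λ i → ℕ.⊓-mono-≤ (decreasing p i) (decreasing q i)
  -- A zero entry of `p` already forces the minimum to be zero.
  ; bound      = bound p
  ; vanishing  = λ i b≤i → cong (_⊓ part q i) (vanishing p i b≤i)
  }
p ∨ q = record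
  { part       = λ i → part p i ⊔ part q i
  ; decreasing = λ i → ℕ.⊔-mono-≤ (decreasing p i) (decreasing q i)
  ; bound      = bound p ⊔ bound q
  ; vanishing  = λ i b≤i → cong₂ _⊔_
      (vanishing p i (ℕ.m⊔n≤o⇒m≤o _ _ b≤i)) (vanishing q i (ℕ.m⊔n≤o⇒n≤o (bound p) _ b≤i))
  }

weight-∧+∨ : ∀ p q → weight (p ∧ q) ℕ.+ weight (p ∨ q) ≡ weight p ℕ.+ weight q
weight-∧+∨ p q = weight-+-cong (p ∧ q) (p ∨ q) p q λ i → m⊓n+m⊔n≡m+n (part p i) (part q i)

-- Interlacing as membership in intervals

module _ (ƛ μ : Partition) where

  -- One interval serves both sides: it confines entry `suc i` of a partition above and entry `i` of
  -- a partition below.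
  lo hi : ℕ → ℕ
  lo i = part (ƛ ∨ μ) (suc i)
  hi i = part (ƛ ∧ μ) i

  -- At index 0 this is the only constraint on the first entry; it makes the popped value
  -- nonnegative.
  above-∨ : ∀ ν → μ ≺ ν × ν ≻ ƛ → ∀ i → part (ƛ ∨ μ) i ≤ part ν i
  above-∨ ν (μ≺ν , ν≻ƛ) i = ℕ.⊔-lub (proj₁ (ν≻ƛ i)) (proj₁ (μ≺ν i))

  above-∈ : ∀ ν → μ ≺ ν × ν ≻ ƛ → ∀ i → part ν (suc i) ∈[ lo i , hi i ]
  above-∈ ν between@(μ≺ν , ν≻ƛ) i =
    above-∨ ν between (suc i) , ℕ.⊓-glb (proj₂ (ν≻ƛ i)) (proj₂ (μ≺ν i))

  below-∈ : ∀ ν′ → μ ≻ ν′ × ν′ ≺ ƛ → ∀ i → part ν′ i ∈[ lo i , hi i ]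
  below-∈ ν′ (μ≻ν′ , ν′≺ƛ) i =
    ℕ.⊔-lub (proj₂ (ν′≺ƛ i)) (proj₂ (μ≻ν′ i)) , ℕ.⊓-glb (proj₁ (ν′≺ƛ i)) (proj₁ (μ≻ν′ i))

  -- Converse of `below-∈`. Being a partition comes for free: `f i` is caught between consecutive
  -- parts of `ƛ`, which gives both monotonicity and vanishing.
  mkBelow : (f : ℕ → ℕ) → (∀ i → f i ∈[ lo i , hi i ]) → Σ Partition (λ ν′ → μ ≻ ν′ × ν′ ≺ ƛ)
  mkBelow f f∈ = record
    { part       = f
    ; decreasing = λ i → ℕ.≤-trans (f≤ƛ (suc i)) (ƛ≤f i)
    ; bound      = bound ƛ
    ; vanishing  = λ i b≤i → ℕ.n≤0⇒n≡0 (subst (f i ≤_) (vanishing ƛ i b≤i) (f≤ƛ i))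
    } , (λ i → f≤μ i , μ≤f i) , (λ i → f≤ƛ i , ƛ≤f i)
    where
    f≤ƛ : ∀ i → f i ≤ part ƛ i
    f≤ƛ i = ℕ.m≤n⊓o⇒m≤n _ _ (proj₂ (f∈ i))
    f≤μ : ∀ i → f i ≤ part μ i
    f≤μ i = ℕ.m≤n⊓o⇒m≤o (part ƛ i) _ (proj₂ (f∈ i))
    ƛ≤f : ∀ i → part ƛ (suc i) ≤ f i
    ƛ≤f i = ℕ.m⊔n≤o⇒m≤o _ _ (proj₁ (f∈ i))
    μ≤f : ∀ i → part μ (suc i) ≤ f i
    μ≤f i = ℕ.m⊔n≤o⇒n≤o (part ƛ (suc i)) _ (proj₁ (f∈ i))

  mkAbove : (f : ℕ → ℕ) → part (ƛ ∨ μ) 0 ≤ f 0 → (∀ i → f (suc i) ∈[ lo i , hi i ]) →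
            Σ Partition (λ ν → μ ≺ ν × ν ≻ ƛ)
  mkAbove f ∨≤f₀ f∈ = record
    { part       = f
    ; decreasing = λ i → ℕ.≤-trans (f≤ƛ i) (ƛ≤f i)
    -- Entry `suc i` is dominated by entry `i` of `ƛ`, so vanishing starts one index later.
    ; bound      = suc (bound ƛ)
    ; vanishing  = λ { (suc i) (s≤s b≤i) → ℕ.n≤0⇒n≡0 (subst (f (suc i) ≤_) (vanishing ƛ i b≤i) (f≤ƛ i)) }
    } , (λ i → μ≤f i , f≤μ i) , (λ i → ƛ≤f i , f≤ƛ i)
    where
    ∨≤f : ∀ i → part (ƛ ∨ μ) i ≤ f i
    ∨≤f zero    = ∨≤f₀
    ∨≤f (suc i) = proj₁ (f∈ i)
    f≤ƛ : ∀ i → f (suc i) ≤ part ƛ i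
    f≤ƛ i = ℕ.m≤n⊓o⇒m≤n _ _ (proj₂ (f∈ i))
    f≤μ : ∀ i → f (suc i) ≤ part μ i
    f≤μ i = ℕ.m≤n⊓o⇒m≤o (part ƛ i) _ (proj₂ (f∈ i))
    ƛ≤f : ∀ i → part ƛ i ≤ f i
    ƛ≤f i = ℕ.m⊔n≤o⇒m≤o _ _ (∨≤f i)
    μ≤f : ∀ i → part μ i ≤ f i
    μ≤f i = ℕ.m⊔n≤o⇒n≤o (part ƛ i) _ (∨≤f i)

  -- The toggle and its inverse

  toggle : Σ Partition (λ ν → μ ≺ ν × ν ≻ ƛ) → Σ Partition (λ ν′ → μ ≻ ν′ × ν′ ≺ ƛ) × ℕ
  toggle (ν , between) =
    mkBelow (λ i → reflect (lo i) (hi i) (part ν (suc i))) (λ i → reflect-∈ (above-∈ ν between i)) ,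
    part ν 0 ∸ part (ƛ ∨ μ) 0

  -- The popped value restores the first entry, and the reflected entries move up one index.
  untoggledPart : (ℕ → ℕ) → ℕ → ℕ → ℕ
  untoggledPart f n zero    = n ℕ.+ part (ƛ ∨ μ) 0
  untoggledPart f n (suc i) = reflect (lo i) (hi i) (f i)

  untoggle : Σ Partition (λ ν′ → μ ≻ ν′ × ν′ ≺ ƛ) × ℕ → Σ Partition (λ ν → μ ≺ ν × ν ≻ ƛ)
  untoggle ((ν′ , between) , n) =
    mkAbove (untoggledPart (part ν′) n) (ℕ.m≤n+m _ n) (λ i → reflect-∈ (below-∈ ν′ between i))

  toggle-inverse : Inverse (Above ƛ μ) (BelowWithPopped ƛ μ)
  toggle-inverse = record
    { to        = toggle
    ; from      = untoggle
    ; to-cong   = λ {x} {y} → toggle-cong {x} {y}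
    ; from-cong = λ {x} {y} → untoggle-cong {x} {y}
    -- Both inverse laws are required up to setoid equality, so each pointwise round trip is
    -- composed with a congruence.
    ; inverse   =
        (λ {y} {x} x≈y →
          let (eq , eq₀) = toggle-cong {x} {untoggle y} x≈y
              (inv , inv₀) = toggle-untoggle y
          in (λ i → trans (eq i) (inv i)) , trans eq₀ inv₀) ,
        (λ {x} {y} y≈x i →
          trans (untoggle-cong {y} {toggle x} y≈x i) (untoggle-toggle x i))
    }
    where
    open import Relation.Binary.Bundles using (Setoid)
    open Setoid (Above ƛ μ) using () renaming (Carrier to A; _≈_ to _≈ᴬ_)
    open Setoid (BelowWithPopped ƛ μ) using () renaming (Carrier to B; _≈_ to _≈ᴮ_)

    toggle-cong : ∀ {x y : A} → x ≈ᴬ y → toggle x ≈ᴮ toggle y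
    toggle-cong x≈y =
      (λ i → cong (reflect (lo i) (hi i)) (x≈y (suc i))) , cong (_∸ part (ƛ ∨ μ) 0) (x≈y 0)

    untoggle-cong : ∀ {x y : B} → x ≈ᴮ y → untoggle x ≈ᴬ untoggle y
    untoggle-cong (_   , n≡m) zero    = cong (ℕ._+ part (ƛ ∨ μ) 0) n≡m
    untoggle-cong (x≈y , _)   (suc i) = cong (reflect (lo i) (hi i)) (x≈y i)

    toggle-untoggle : ∀ y → toggle (untoggle y) ≈ᴮ y
    toggle-untoggle ((ν′ , between) , n) =
      (λ i → reflect-involutive (below-∈ ν′ between i)) , ℕ.m+n∸n≡m n (part (ƛ ∨ μ) 0)

    untoggle-toggle : ∀ x → untoggle (toggle x) ≈ᴬ x
    untoggle-toggle (ν , between) zero    = ℕ.m∸n+n≡m (above-∨ ν between 0)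
    untoggle-toggle (ν , between) (suc i) = reflect-involutive (above-∈ ν between i)

  -- The toggle formula and weight preservation

  module _ (ν : Partition) (between : μ ≺ ν × ν ≻ ƛ) where

    private
      Tν : Partition
      Tν = proj₁ (proj₁ (toggle (ν , between)))

      n : ℕ
      n = proj₂ (toggle (ν , between))

    toggle-isToggle : IsToggle ƛ μ ν Tν n
    toggle-isToggle =
      (λ i → m+n≡o⇒+m≡+o-+n (reflect+id (above-∈ ν between i))) ,
      m+n≡o⇒+m≡+o-+n (ℕ.m∸n+n≡m (above-∨ ν between 0))

    weight-toggle : weight ν ℕ.+ weight Tν ≡ weight ƛ ℕ.+ weight μ ℕ.+ n
    weight-toggle = begin
      weight ν ℕ.+ weight Tν
        ≡⟨ cong (ℕ._+ weight Tν) (weight-head-tail ν) ⟩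
      part ν 0 ℕ.+ weight (tail ν) ℕ.+ weight Tν
        -- The head of `ν` has no partner in `Tν`; it is written as the popped value plus the head
        -- of `ƛ ∨ μ`.
        ≡⟨ cong (λ h → h ℕ.+ weight (tail ν) ℕ.+ weight Tν) (ℕ.m∸n+n≡m (above-∨ ν between 0)) ⟨
      n ℕ.+ part (ƛ ∨ μ) 0 ℕ.+ weight (tail ν) ℕ.+ weight Tν
        ≡⟨ regroup₁ n (part (ƛ ∨ μ) 0) (weight (tail ν)) (weight Tν) ⟩
      n ℕ.+ part (ƛ ∨ μ) 0 ℕ.+ (weight Tν ℕ.+ weight (tail ν))
        -- A reflected entry and its original add up to the two endpoints, here the entries of
        -- `ƛ ∧ μ` and of the tail of `ƛ ∨ μ`.
        ≡⟨ cong (n ℕ.+ part (ƛ ∨ μ) 0 ℕ.+_)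
             (weight-+-cong Tν (tail ν) (ƛ ∧ μ) (tail (ƛ ∨ μ)) λ i → reflect+id (above-∈ ν between i)) ⟩
      n ℕ.+ part (ƛ ∨ μ) 0 ℕ.+ (weight (ƛ ∧ μ) ℕ.+ weight (tail (ƛ ∨ μ)))
        ≡⟨ regroup₂ n (part (ƛ ∨ μ) 0) (weight (ƛ ∧ μ)) (weight (tail (ƛ ∨ μ))) ⟩
      weight (ƛ ∧ μ) ℕ.+ (part (ƛ ∨ μ) 0 ℕ.+ weight (tail (ƛ ∨ μ))) ℕ.+ n
        -- The head split off from `ν` completes the tail to the whole of `ƛ ∨ μ`.
        ≡⟨ cong (λ w → weight (ƛ ∧ μ) ℕ.+ w ℕ.+ n) (weight-head-tail (ƛ ∨ μ)) ⟨
      weight (ƛ ∧ μ) ℕ.+ weight (ƛ ∨ μ) ℕ.+ n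
        ≡⟨ cong (ℕ._+ n) (weight-∧+∨ ƛ μ) ⟩
      weight ƛ ℕ.+ weight μ ℕ.+ n ∎
      where
      open ≡-Reasoning
      regroup₁ : ∀ a b c d → a ℕ.+ b ℕ.+ c ℕ.+ d ≡ a ℕ.+ b ℕ.+ (d ℕ.+ c)
      regroup₁ = ℕ-Solver.solve-∀
      regroup₂ : ∀ a b c d → a ℕ.+ b ℕ.+ (c ℕ.+ d) ≡ c ℕ.+ (b ℕ.+ d) ℕ.+ a
      regroup₂ = ℕ-Solver.solve-∀

+-balance : ∀ p q r s n → p ℕ.+ q ≡ r ℕ.+ s ℕ.+ n → + p - + r ≡ + s - + q + + n
+-balance p q r s n eq =
  trans (cong (_- + r) (m+n≡o⇒+m≡+o-+n {p} eq)) (regroup (+ q) (+ r) (+ s) (+ n))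
  where
  regroup : ∀ (j k l m : ℤ) → k + l + m - j - k ≡ l - j + m
  regroup = ℤ-Solver.solve-∀

proposition3p4 : (ƛ μ : Partition) →
    Σ[ toggle ∈ Bijection (Above ƛ μ) (BelowWithPopped ƛ μ) ]
    ((ν : Partition) (interlace : μ ≺ ν × ν ≻ ƛ) →
    let image = Bijection.to toggle (ν , interlace)
        Tν    = proj₁ (proj₁ image)
        n     = proj₂ image
    in IsToggle ƛ μ ν Tν n
    × (+ weight ν - + weight ƛ ≡ + weight μ - + weight Tν + + n)
    × (+ weight ν - + weight μ ≡ + weight ƛ - + weight Tν + + n))
proposition3p4 ƛ μ = Inverse⇒Bijection (toggle-inverse ƛ μ) , λ ν interlace →
  let ((Tν , _) , n) = toggle ƛ μ (ν , interlace)
      balance = weight-toggle ƛ μ ν interlace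
  in toggle-isToggle ƛ μ ν interlace ,
     +-balance (weight ν) (weight Tν) (weight ƛ) (weight μ) n balance ,
     -- The balance is symmetric in `ƛ` and `μ`, so exchanging them yields the second identity.
     +-balance (weight ν) (weight Tν) (weight μ) (weight ƛ) n
       (trans balance (cong (ℕ._+ n) (ℕ.+-comm (weight ƛ) (weight μ))))
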